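{- Let $n\ge 3$ and let $K$ be a proper $4$-coloring of $H_2(n,n-1)$. (1) If $T(K)=\{(x,y): x+y\in\{f_i,f_j\}\}$ for some $1\le i<j\le n$, then $K$ is the $(i,j)$-coordinate coloring (up to renaming of colors), i.e. its color classes are the four sets $\{x\in\mathbb{Z}_2^n: (x_i,x_j)=(a,b)\}$, $a,b\in\mathbb{Z}_2$. (2) If $T(K)=\{(x,y): x+y\in\{\mathbb{1},f_j\}\}$ for some $j\in\{1,\dots,n\}$, then $n$ is even and the color classes of $K$ are the four sets $\mathcal{A}^{\nu}_{\mu}=\{v\in\mathbb{Z}_2^n: \mathrm{wt}(v)\equiv \nu \pmod 2,\ v_j=\mu\}$, $\nu,\mu\in\{0,1\}$. As a consequence, every proper $4$-coloring $K$ of $H_2(n,n-1)$ with $\mathrm{rb}(K)=\frac{2}{n+1}$ is even.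
   Context: $H_2(n,n-1)$ is the simple undirected graph with vertex set $\mathbb{Z}_2^n$ in which $x,y$ are adjacent iff their Hamming distance is at least $n-1$; $\mathrm{wt}$ is Hamming weight. $e_k$ is the $k$-th standard basis vector, $\mathbb{1}$ the all-ones vector, $f_k=e_k+\mathbb{1}$. For a proper $k$-coloring $K$ of a simple graph $G=(V,E)$, an edge $(x,y)$ is a transition edge if swapping the colors of $x$ and $y$ (all other colors unchanged) yields again a proper $k$-coloring; $T(K)$ is the set of transition edges and $\mathrm{rb}(K)=|T(K)|/|E|$. A coloring is even if all color classes have the same cardinality. -}

module Defs where

open import Data.Bool using (if_then_else_)
open import Data.Empty using (⊥-elim)
open import Data.Fin using (Fin)
open import Data.Integer using (+_)
open import Data.List using (List; []; _∷_; _++_; map; filter; length; cartesianProductWith)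
open import Data.List.Membership.Propositional using (_∈_)
open import Data.List.Membership.Propositional.Properties using (∈-++⁺ˡ; ∈-++⁺ʳ; ∈-map⁺; ∈-filter⁺; ∈-cartesianProductWith⁺)
open import Data.List.Relation.Unary.All as All using ()
open import Data.List.Relation.Unary.AllPairs using ([]; _∷_)
open import Data.List.Relation.Unary.Any using (here; there)
open import Data.List.Relation.Unary.Unique.Propositional using (Unique)
open import Data.List.Relation.Unary.Unique.Propositional.Properties using (cartesianProductWith⁺)
open import Data.Nat using (ℕ; zero; suc; _∸_; _≤_; _≤?_; NonZero; parity)
open import Data.Nat.Properties using (≤-trans; ≤-reflexive; n≤1+n)
open import Data.Parity using (Parity; 0ℙ; 1ℙ) renaming (_+_ to _+₂_; _≟_ to _≟₂_)
open import Data.Product using (Σ; _×_; _,_; proj₁; proj₂; uncurry)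
open import Data.Rational using (ℚ; _/_)
open import Data.Sum using (_⊎_; inj₁; inj₂)
open import Data.Vec using (Vec; []; _∷_; replicate; zip; zipWith; count; lookup; _[_]≔_)
open import Data.Vec.Properties using (≡-dec; ∷-injective)
open import Function using (_↔_; _⇔_; Inverse)
open import Relation.Binary.Definitions using (Decidable; DecidableEquality; Symmetric)
open import Relation.Binary.PropositionalEquality using (_≡_; _≢_; refl; sym; cong; ≢-sym)
open import Relation.Nullary using (¬_; Dec; does)
open import Relation.Nullary.Decidable using (¬?; _×-dec_; _→-dec_; map′)
import Data.Fin.Properties as Fin

unorderedPairs : {A : Set} → List A → List (A × A)
unorderedPairs []       = []
unorderedPairs (x ∷ xs) = map (x ,_) xs ++ unorderedPairs xs

∈-unorderedPairs⁺ : {A : Set} {x y : A} {xs : List A} → x ≢ y → x ∈ xs → y ∈ xs →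
                    (x , y) ∈ unorderedPairs xs ⊎ (y , x) ∈ unorderedPairs xs
∈-unorderedPairs⁺ x≢y (here refl) (here refl) = ⊥-elim (x≢y refl)
∈-unorderedPairs⁺ x≢y (here refl) (there y∈)  = inj₁ (∈-++⁺ˡ (∈-map⁺ _ y∈))
∈-unorderedPairs⁺ x≢y (there x∈)  (here refl) = inj₂ (∈-++⁺ˡ (∈-map⁺ _ x∈))
∈-unorderedPairs⁺ x≢y (there x∈)  (there y∈)  with ∈-unorderedPairs⁺ x≢y x∈ y∈
... | inj₁ p = inj₁ (∈-++⁺ʳ _ p)
... | inj₂ p = inj₂ (∈-++⁺ʳ _ p)

∈⇒nonZero : {A : Set} {x : A} {xs : List A} → x ∈ xs → NonZero (length xs)
∈⇒nonZero (here _)  = _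
∈⇒nonZero (there _) = _

record FiniteSimpleGraph : Set₁ where
  field
    Vertex     : Set
    _≟_        : DecidableEquality Vertex
    vertices   : List Vertex
    complete   : ∀ x → x ∈ vertices
    unique     : Unique vertices
    Adj        : Vertex → Vertex → Set
    Adj?       : Decidable Adj
    Adj-sym    : Symmetric Adj
    Adj-irrefl : ∀ {x} → ¬ Adj x x

  -- Each edge {x , y} occurs exactly once, in one of its two orientations.
  edges : List (Vertex × Vertex)
  edges = filter (uncurry Adj?) (unorderedPairs vertices)

  ∣E∣ : ℕ
  ∣E∣ = length edges

  ∣E∣-nonZero : ∀ {x y} → Adj x y → NonZero ∣E∣
  ∣E∣-nonZero {x} {y} xy
    with ∈-unorderedPairs⁺ (λ { refl → Adj-irrefl xy }) (complete x) (complete y)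
  ... | inj₁ p = ∈⇒nonZero (∈-filter⁺ (uncurry Adj?) p xy)
  ... | inj₂ p = ∈⇒nonZero (∈-filter⁺ (uncurry Adj?) p (Adj-sym xy))

  ∀-dec : {P : Vertex → Set} → (∀ x → Dec (P x)) → Dec (∀ x → P x)
  ∀-dec P? = map′ (λ a x → All.lookup a (complete x)) (λ f → All.tabulate (λ {x} _ → f x))
                  (All.all? P? vertices)

  Coloring : ℕ → Set
  Coloring k = Vertex → Fin k

  module _ {k : ℕ} where

    Proper : Coloring k → Set
    Proper K = ∀ x y → Adj x y → K x ≢ K y

    Proper? : ∀ K → Dec (Proper K)
    Proper? K = ∀-dec λ x → ∀-dec λ y → Adj? x y →-dec ¬? (K x Fin.≟ K y)

    swapColors : Coloring k → Vertex → Vertex → Coloring k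
    swapColors K x y v =
      if does (v ≟ x) then K y else if does (v ≟ y) then K x else K v

    -- The set T(K), as a relation on vertices.
    Transition : Coloring k → Vertex → Vertex → Set
    Transition K x y = Adj x y × Proper (swapColors K x y)

    Transition? : ∀ K → Decidable (Transition K)
    Transition? K x y = Adj? x y ×-dec Proper? (swapColors K x y)

    ∣T∣ : Coloring k → ℕ
    ∣T∣ K = length (filter (uncurry (Transition? K)) edges)

    rb : .{{_ : NonZero ∣E∣}} → Coloring k → ℚ
    rb K = + ∣T∣ K / ∣E∣

    classSize : Coloring k → Fin k → ℕ
    classSize K c = length (filter (λ x → K x Fin.≟ c) vertices)

    Even : Coloring k → Set
    Even K = ∀ c d → classSize K c ≡ classSize K d

    -- The color classes of K are exactly the sets S i, one color for each index i.
    HasColorClasses : {I : Set} → Coloring k → (I → Vertex → Set) → Set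
    HasColorClasses {I} K S =
      Σ (I ↔ Fin k) λ φ → ∀ i x → K x ≡ Inverse.to φ i ⇔ S i x

-- The type Parity of the library is the field with two elements.
ℤ₂^_ : ℕ → Set
ℤ₂^ n = Vec Parity n

infixl 6 _⊕_
_⊕_ : ∀ {n} → ℤ₂^ n → ℤ₂^ n → ℤ₂^ n
_⊕_ = zipWith _+₂_

wt : ∀ {n} → ℤ₂^ n → ℕ
wt = count (λ a → ¬? (a ≟₂ 0ℙ))

hammingDistance : ∀ {n} → ℤ₂^ n → ℤ₂^ n → ℕ
hammingDistance x y = count (λ ab → ¬? (proj₁ ab ≟₂ proj₂ ab)) (zip x y)

e : ∀ {n} → Fin n → ℤ₂^ n
e {n} k = replicate n 0ℙ [ k ]≔ 1ℙ

𝟙 : ∀ {n} → ℤ₂^ n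
𝟙 {n} = replicate n 1ℙ

f : ∀ {n} → Fin n → ℤ₂^ n
f k = e k ⊕ 𝟙

allVectors : ∀ n → List (ℤ₂^ n)
allVectors zero    = [] ∷ []
allVectors (suc n) = cartesianProductWith _∷_ (0ℙ ∷ 1ℙ ∷ []) (allVectors n)

allVectors-complete : ∀ {n} (x : ℤ₂^ n) → x ∈ allVectors n
allVectors-complete []      = here refl
allVectors-complete (a ∷ x) = ∈-cartesianProductWith⁺ _∷_ (a∈ a) (allVectors-complete x)
  where
  a∈ : ∀ a → a ∈ (0ℙ ∷ 1ℙ ∷ [])
  a∈ 0ℙ = here refl
  a∈ 1ℙ = there (here refl)

allVectors-unique : ∀ n → Unique (allVectors n)
allVectors-unique zero    = All.[] ∷ []
allVectors-unique (suc n) =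
  cartesianProductWith⁺ _∷_ ∷-injective
    (((λ ()) All.∷ All.[]) ∷ All.[] ∷ []) (allVectors-unique n)

hammingDistance-sym : ∀ {n} (x y : ℤ₂^ n) → hammingDistance x y ≡ hammingDistance y x
hammingDistance-sym []       []       = refl
hammingDistance-sym (0ℙ ∷ x) (0ℙ ∷ y) = hammingDistance-sym x y
hammingDistance-sym (0ℙ ∷ x) (1ℙ ∷ y) = cong suc (hammingDistance-sym x y)
hammingDistance-sym (1ℙ ∷ x) (0ℙ ∷ y) = cong suc (hammingDistance-sym x y)
hammingDistance-sym (1ℙ ∷ x) (1ℙ ∷ y) = hammingDistance-sym x y

-- The condition x ≢ y is implied by the other one unless d = 0, where it is
-- needed to exclude loops.
H₂ : (n d : ℕ) → FiniteSimpleGraph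
H₂ n d = record
  { Vertex     = ℤ₂^ n
  ; _≟_        = ≡-dec _≟₂_
  ; vertices   = allVectors n
  ; complete   = allVectors-complete
  ; unique     = allVectors-unique n
  ; Adj        = λ x y → x ≢ y × d ≤ hammingDistance x y
  ; Adj?       = λ x y → ¬? (≡-dec _≟₂_ x y) ×-dec (d ≤? hammingDistance x y)
  ; Adj-sym    = λ {x} {y} (x≢y , d≤) →
                   ≢-sym x≢y , ≤-trans d≤ (≤-reflexive (hammingDistance-sym x y))
  ; Adj-irrefl = λ (x≢x , _) → x≢x refl
  }

hammingDistance-0-𝟙 : ∀ n → hammingDistance (replicate n 0ℙ) 𝟙 ≡ n
hammingDistance-0-𝟙 zero    = refl
hammingDistance-0-𝟙 (suc n) = cong suc (hammingDistance-0-𝟙 n)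

H₂-nonZero : ∀ {n} → 3 ≤ n → NonZero (FiniteSimpleGraph.∣E∣ (H₂ n (n ∸ 1)))
H₂-nonZero {suc n} _ = FiniteSimpleGraph.∣E∣-nonZero (H₂ (suc n) n)
  {replicate (suc n) 0ℙ} {𝟙}
  ((λ ()) , ≤-trans (n≤1+n n) (≤-reflexive (sym (hammingDistance-0-𝟙 (suc n)))))

TransitionsAre : ∀ {n} → FiniteSimpleGraph.Coloring (H₂ n (n ∸ 1)) 4 → ℤ₂^ n → ℤ₂^ n → Set
TransitionsAre {n} K g h =
  ∀ x y → FiniteSimpleGraph.Transition (H₂ n (n ∸ 1)) K x y ⇔ (x ⊕ y ≡ g ⊎ x ⊕ y ≡ h)

coordinateClass : ∀ {n} → Fin n → Fin n → Parity × Parity → ℤ₂^ n → Set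
coordinateClass i j (a , b) x = lookup x i ≡ a × lookup x j ≡ b

𝒜 : ∀ {n} → Fin n → Parity × Parity → ℤ₂^ n → Set
𝒜 j (ν , μ) v = parity (wt v) ≡ ν × lookup v j ≡ μ

{-# OPTIONS --safe #-}
module Submission where

-- If xy is a transition edge, then y is the only neighbour of x with the color
-- of y.  Since x has n + 1 ≥ 4 neighbours and they have three colors, it lies on
-- at most two transition edges, and if it lies on two, then all its other
-- neighbours share the remaining color.
--
-- When the transition edges are x + y ∈ {g , h}, two steps along other generators
-- u, v therefore preserve the color: K (x + u + v) = K x.  For {f i , f j} this makes
-- K invariant under e k, k ≠ i , j; for {𝟙 , f j} under e k + e l, k , l ≠ j, and
-- then n is even, as otherwise 0 and its neighbour f j would have the same color.
--
-- When rb K = 2 / (n + 1), the handshake lemma forces every vertex to lie on exactly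
-- two transition edges.  For colors c ≠ d give the transition edges weight n − 1
-- and the other edges weight 1; the edges from a vertex of color c to the color class
-- of d then have total weight n − 1, so double counting shows that both classes have
-- the same size.

open import Defs
open import Data.Bool using (if_then_else_; true; false)
open import Data.Fin using (Fin; zero; suc; punchIn; punchOut) renaming (_<_ to _<ᶠ_)
open import Data.List using (List; []; _∷_; _++_; map; filter; length)
open import Data.List.Membership.Propositional using (_∈_)
open import Data.List.Properties using (map-cong; map-++; map-∘; ++-identityʳ)
open import Data.List.Relation.Unary.All as All using (All)
open import Data.List.Relation.Unary.All.Properties using (¬Any⇒All¬)
open import Data.List.Relation.Unary.AllPairs using ([]; _∷_)
open import Data.List.Relation.Unary.Any using (any?; here; there; satisfied)
open import Data.List.Relation.Unary.Unique.Propositional using (Unique)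
open import Data.Nat using (ℕ; zero; suc; _+_; _*_; _∸_; _≤_; z≤n; s≤s; _≤?_; parity; s≤s⁻¹)
open import Data.Nat.Divisibility using (_∣_; ∣-refl; _∣0; ∣m∣n⇒∣m+n)
open import Data.Nat.ListAction using (sum)
open import Data.Nat.ListAction.Properties using (sum-++)
open import Data.Nat.Properties using (+-0-commutativeMonoid; +-comm; +-identityʳ; +-mono-≤; +-cancelˡ-≡; +-monoʳ-≤; ≤-antisym; ≤-refl; ≤-reflexive; ≤-trans; *-comm; *-cancelˡ-≡; *-distribˡ-+; *-identityʳ; *-monoʳ-≤; *-zeroʳ; suc-injective; +-cancelʳ-≤; n≤1+n; 1+n≰n)
open import Data.Nat.Solver using (module +-*-Solver)
open import Data.Parity using (Parity; 0ℙ; 1ℙ; _⁻¹) renaming (_+_ to _+₂_)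
open import Data.Product using (_×_; _,_; proj₁; proj₂; uncurry; ∃)
open import Data.Rational using (_/_)
open import Data.Rational.Properties using (normalize-injective-≃)
open import Data.Sum using (_⊎_; inj₁; inj₂)
open import Data.Vec using ([]; _∷_; replicate; lookup; zip)
open import Data.Vec.Properties using (count≤n; lookup-replicate; lookup-zipWith; lookup∘update; lookup∘update′; zipWith-assoc; zipWith-comm; zipWith-identityˡ; zipWith-identityʳ)
open import Data.Vec.Relation.Unary.All using ([]; _∷_)
open import Data.Vec.Relation.Unary.AllPairs using ([]; _∷_)
open import Data.Vec.Relation.Unary.Unique.Propositional using () renaming (Unique to Uniqueᵛ)
open import Data.Vec.Relation.Unary.Unique.Propositional.Properties using (lookup-injective)
open import Function using (_∘_; _⇔_; mk⇔; Equivalence; _↔_; mk↔ₛ′)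
open import Relation.Binary.Definitions using (Decidable; Symmetric)
open import Relation.Binary.PropositionalEquality using (_≡_; _≢_; refl; sym; trans; cong; cong₂; subst; module ≡-Reasoning)
open import Relation.Nullary using (¬_; Dec; yes; no; does; contradiction)
open import Relation.Nullary.Decidable using (dec-true; dec-false; does-⇔; _×-dec_)
import Algebra.Properties.CommutativeMonoid.Sum as CommutativeMonoidSum
import Data.Fin.Properties as Fin
import Data.Parity.Properties as ℙ

open CommutativeMonoidSum +-0-commutativeMonoid using (sum-remove; sum-replicate-zero) renaming (sum to sumᶠ; ∑-distrib-+ to sumᶠ-distrib-+)

-- Sums over lists

module _ {A : Set} where

  ∑ : List A → (A → ℕ) → ℕ
  ∑ xs g = sum (map g xs)

  ∑-cong : ∀ {g h} xs → (∀ x → g x ≡ h x) → ∑ xs g ≡ ∑ xs h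
  ∑-cong xs g≗h = cong sum (map-cong g≗h xs)

  ∑-zero : ∀ xs → ∑ xs (λ _ → 0) ≡ 0
  ∑-zero []       = refl
  ∑-zero (x ∷ xs) = ∑-zero xs

  ∑-distrib-+ : ∀ g h xs → ∑ xs (λ x → g x + h x) ≡ ∑ xs g + ∑ xs h
  ∑-distrib-+ g h []       = refl
  ∑-distrib-+ g h (x ∷ xs) = trans (cong (g x + h x +_) (∑-distrib-+ g h xs))
    (solve 4 (λ a b c d → (a :+ b) :+ (c :+ d) := (a :+ c) :+ (b :+ d)) refl
      (g x) (h x) (∑ xs g) (∑ xs h))
    where open +-*-Solver

  *-distribˡ-∑ : ∀ c g xs → c * ∑ xs g ≡ ∑ xs (λ x → c * g x)
  *-distribˡ-∑ c g []       = *-zeroʳ c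
  *-distribˡ-∑ c g (x ∷ xs) =
    trans (*-distribˡ-+ c (g x) (∑ xs g)) (cong (c * g x +_) (*-distribˡ-∑ c g xs))

  ∑-mono-≤ : ∀ {g h} xs → (∀ x → g x ≤ h x) → ∑ xs g ≤ ∑ xs h
  ∑-mono-≤ []       g≤h = z≤n
  ∑-mono-≤ (x ∷ xs) g≤h = +-mono-≤ (g≤h x) (∑-mono-≤ xs g≤h)

  -- Equal totals leave no slack in any term of a termwise bound. This turns the global count of
  -- transition edges into a statement about every vertex.
  ∑-≡⇒≗ : ∀ {g h x} xs → (∀ x → g x ≤ h x) → ∑ xs g ≡ ∑ xs h → x ∈ xs → g x ≡ h x
  ∑-≡⇒≗ {g} {h} (x ∷ xs) g≤h eq x∈ = go x∈
    where
    tail≤ : ∑ xs g ≤ ∑ xs h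
    tail≤ = ∑-mono-≤ xs g≤h

    head≡ : g x ≡ h x
    head≡ = ≤-antisym (g≤h x)
      (+-cancelʳ-≤ (∑ xs h) _ _ (≤-trans (≤-reflexive (sym eq)) (+-monoʳ-≤ (g x) tail≤)))

    go : ∀ {y} → y ∈ x ∷ xs → g y ≡ h y
    go (here refl) = head≡
    go (there y∈)  = ∑-≡⇒≗ xs g≤h
      (+-cancelˡ-≡ (h x) _ _ (trans (cong (_+ ∑ xs g) (sym head≡)) eq)) y∈

  sumᶠ-∑-comm : ∀ {n} (g : Fin n → A → ℕ) xs →
               sumᶠ (λ i → ∑ xs (g i)) ≡ ∑ xs (λ x → sumᶠ (λ i → g i x))
  sumᶠ-∑-comm {n} g []       = sum-replicate-zero n
  sumᶠ-∑-comm     g (x ∷ xs) =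
    trans (sumᶠ-distrib-+ (λ i → g i x) (λ i → ∑ xs (g i)))
          (cong (sumᶠ (λ i → g i x) +_) (sumᶠ-∑-comm g xs))

∑-comm : {A B : Set} (g : A → B → ℕ) → ∀ xs ys →
         ∑ xs (λ x → ∑ ys (g x)) ≡ ∑ ys (λ y → ∑ xs (λ x → g x y))
∑-comm g []       ys = sym (∑-zero ys)
∑-comm g (x ∷ xs) ys =
  trans (cong (∑ ys (g x) +_) (∑-comm g xs ys))
        (sym (∑-distrib-+ (g x) (λ y → ∑ xs (λ x → g x y)) ys))

-- Double counting: with `p` and `q` indicators of two classes, the total weight between the classes
-- is collected from either end.
∑-*-symmetric : {A : Set} (p q : A → ℕ) (w : A → A → ℕ) → (∀ x y → w x y ≡ w y x) → ∀ xs →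
                ∑ xs (λ x → p x * ∑ xs (λ y → q y * w x y)) ≡
                ∑ xs (λ y → q y * ∑ xs (λ x → p x * w y x))
∑-*-symmetric p q w w-sym xs = begin
  ∑ xs (λ x → p x * ∑ xs (λ y → q y * w x y))
    ≡⟨ ∑-cong xs (λ x → *-distribˡ-∑ (p x) _ xs) ⟩
  ∑ xs (λ x → ∑ xs (λ y → p x * (q y * w x y)))
    ≡⟨ ∑-comm (λ x y → p x * (q y * w x y)) xs xs ⟩
  ∑ xs (λ y → ∑ xs (λ x → p x * (q y * w x y)))
    ≡⟨ ∑-cong xs (λ y → ∑-cong xs λ x → rearrange x y) ⟩
  ∑ xs (λ y → ∑ xs (λ x → q y * (p x * w y x)))
    ≡⟨ ∑-cong xs (λ y → *-distribˡ-∑ (q y) _ xs) ⟨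
  ∑ xs (λ y → q y * ∑ xs (λ x → p x * w y x)) ∎
  where
  open ≡-Reasoning
  rearrange : ∀ x y → p x * (q y * w x y) ≡ q y * (p x * w y x)
  rearrange x y rewrite w-sym x y =
    solve 3 (λ a b c → a :* (b :* c) := b :* (a :* c)) refl (p x) (q y) (w y x)
    where open +-*-Solver

-- Iverson brackets

⟦_⟧ : {P : Set} → Dec P → ℕ
⟦ P? ⟧ = if does P? then 1 else 0

⟦⟧-true : {P : Set} (P? : Dec P) → P → ⟦ P? ⟧ ≡ 1
⟦⟧-true P? p = cong (if_then 1 else 0) (dec-true P? p)

⟦⟧-false : {P : Set} (P? : Dec P) → ¬ P → ⟦ P? ⟧ ≡ 0
⟦⟧-false P? ¬p = cong (if_then 1 else 0) (dec-false P? ¬p)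

⟦⟧-⇔ : {P Q : Set} (P? : Dec P) (Q? : Dec Q) → P ⇔ Q → ⟦ P? ⟧ ≡ ⟦ Q? ⟧
⟦⟧-⇔ P? Q? P⇔Q = cong (if_then 1 else 0) (does-⇔ P⇔Q P? Q?)

⟦⟧-×-dec : {P Q : Set} (P? : Dec P) (Q? : Dec Q) → ⟦ P? ×-dec Q? ⟧ ≡ ⟦ P? ⟧ * ⟦ Q? ⟧
⟦⟧-×-dec P? Q? with does P?
... | true  = sym (+-identityʳ _)
... | false = refl

length-filter-∑ : {A : Set} {P : A → Set} (P? : ∀ x → Dec (P x)) → ∀ xs →
                  length (filter P? xs) ≡ ∑ xs (λ x → ⟦ P? x ⟧)
length-filter-∑ P? []       = refl
length-filter-∑ P? (x ∷ xs) with does (P? x)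
... | true  = cong suc (length-filter-∑ P? xs)
... | false = length-filter-∑ P? xs

∑-filter : {A : Set} {P : A → Set} (P? : ∀ x → Dec (P x)) (g : A → ℕ) → ∀ xs →
           (∀ x → ¬ P x → g x ≡ 0) → ∑ (filter P? xs) g ≡ ∑ xs g
∑-filter P? g []       g≡0 = refl
∑-filter P? g (x ∷ xs) g≡0 with P? x
... | yes _  = cong (g x +_) (∑-filter P? g xs g≡0)
... | no ¬px = trans (∑-filter P? g xs g≡0) (cong (_+ ∑ xs g) (sym (g≡0 x ¬px)))

module _ {A : Set} {P : A → Set} (P? : ∀ x → Dec (P x)) where

  ∑-⟦⟧-none : ∀ xs → All (¬_ ∘ P) xs → ∑ xs (λ x → ⟦ P? x ⟧) ≡ 0
  ∑-⟦⟧-none []       All.[]         = refl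
  ∑-⟦⟧-none (x ∷ xs) (¬px All.∷ ps) = cong₂ _+_ (⟦⟧-false (P? x) ¬px) (∑-⟦⟧-none xs ps)

  ∑-⟦⟧-unique : ∀ {y xs} → Unique xs → y ∈ xs → P y → (∀ z → P z → z ≡ y) →
                ∑ xs (λ x → ⟦ P? x ⟧) ≡ 1
  ∑-⟦⟧-unique (x∉ ∷ _)  (here refl) py only =
    cong₂ _+_ (⟦⟧-true (P? _) py)
              (∑-⟦⟧-none _ (All.map (λ x≢z pz → x≢z (sym (only _ pz))) x∉))
  ∑-⟦⟧-unique (x∉ ∷ xs!) (there y∈) py only =
    cong₂ _+_ (⟦⟧-false (P? _) (λ px → All.lookup x∉ y∈ (only _ px)))
              (∑-⟦⟧-unique xs! y∈ py only)

-- The handshake lemma. The diagonal vanishes by irreflexivity, and symmetry makes the row and the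
-- column of the head `x` equal, which produces the factor 2.
∑-unorderedPairs : {A : Set} {R : A → A → Set} (R? : Decidable R) → Symmetric R →
                   (∀ {x} → ¬ R x x) → ∀ xs →
                   ∑ xs (λ x → ∑ xs (λ y → ⟦ R? x y ⟧)) ≡
                   2 * ∑ (unorderedPairs xs) (λ p → ⟦ uncurry R? p ⟧)
∑-unorderedPairs R? R-sym R-irrefl []       = refl
∑-unorderedPairs R? R-sym R-irrefl (x ∷ xs) = begin
  (r x x + ∑ xs (r x)) + ∑ xs (λ z → r z x + ∑ xs (r z))
    ≡⟨ cong₂ _+_ (cong (_+ ∑ xs (r x)) (⟦⟧-false (R? x x) R-irrefl))
                 (∑-distrib-+ (λ z → r z x) (λ z → ∑ xs (r z)) xs) ⟩
  ∑ xs (r x) + (∑ xs (λ z → r z x) + ∑ xs (λ z → ∑ xs (r z)))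
    ≡⟨ cong (∑ xs (r x) +_) (cong₂ _+_
         (∑-cong xs (λ z → ⟦⟧-⇔ (R? z x) (R? x z) (mk⇔ R-sym R-sym)))
         (∑-unorderedPairs R? R-sym R-irrefl xs)) ⟩
  ∑ xs (r x) + (∑ xs (r x) + 2 * ∑ (unorderedPairs xs) r′)
    ≡⟨ solve 2 (λ a b → a :+ (a :+ con 2 :* b) := con 2 :* (a :+ b)) refl
         (∑ xs (r x)) (∑ (unorderedPairs xs) r′) ⟩
  2 * (∑ xs (r x) + ∑ (unorderedPairs xs) r′)
    ≡⟨ cong (λ s → 2 * (s + ∑ (unorderedPairs xs) r′)) (cong sum (map-∘ xs)) ⟩
  2 * (∑ (map (x ,_) xs) r′ + ∑ (unorderedPairs xs) r′)
    ≡⟨ cong (2 *_) (sum-++ (map r′ (map (x ,_) xs)) _) ⟨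
  2 * sum (map r′ (map (x ,_) xs) ++ map r′ (unorderedPairs xs))
    ≡⟨ cong (λ l → 2 * sum l) (map-++ r′ (map (x ,_) xs) (unorderedPairs xs)) ⟨
  2 * ∑ (map (x ,_) xs ++ unorderedPairs xs) r′ ∎
  where
  open ≡-Reasoning
  open +-*-Solver using (solve; _:=_; _:+_; _:*_; con)
  r : _ → _ → ℕ
  r y z = ⟦ R? y z ⟧
  r′ : _ × _ → ℕ
  r′ p = ⟦ uncurry R? p ⟧

-- Transition edges of a proper coloring

module Transitions (G : FiniteSimpleGraph) where
  open FiniteSimpleGraph G

  module _ {k : ℕ} (K : Coloring k) where

    swapColors-comm : ∀ x y v → swapColors K x y v ≡ swapColors K y x v
    swapColors-comm x y v with v ≟ x | v ≟ y
    ... | yes refl | yes refl = refl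
    ... | yes _    | no _     = refl
    ... | no _     | yes _    = refl
    ... | no _     | no _     = refl

    Transition-sym : Symmetric (Transition K)
    Transition-sym {x} {y} (xy , proper) = Adj-sym xy , λ u v uv eq →
      proper u v uv (trans (swapColors-comm x y u) (trans eq (swapColors-comm y x v)))

    Transition-irrefl : ∀ {x} → ¬ Transition K x x
    Transition-irrefl (xx , _) = Adj-irrefl xx

    -- After the swap `x` carries the color of `y`, while a neighbour `z` other than `y` keeps its
    -- own. If `z` had the color of `y`, the edge from `x` to `z` would become monochromatic.
    Transition-unique : ∀ {x y z} → Transition K x y → Adj x z → K z ≡ K y → z ≡ y
    Transition-unique {x} {y} {z} (xy , proper) xz Kz≡Ky with z ≟ y
    ... | yes z≡y = z≡y
    ... | no  z≢y = contradiction (trans swap-x (trans (sym Kz≡Ky) (sym swap-z))) (proper x z xz)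
      where
      swap-x : swapColors K x y x ≡ K y
      swap-x = cong (if_then K y else if does (x ≟ y) then K x else K x) (dec-true (x ≟ x) refl)

      z≢x : z ≢ x
      z≢x refl = Adj-irrefl xz

      swap-z : swapColors K x y z ≡ K z
      swap-z rewrite dec-false (z ≟ x) z≢x | dec-false (z ≟ y) z≢y = refl

-- Among the c neighbours of one fixed color there are t transition neighbours.
Single : ℕ → ℕ → Set
Single t c = t ≡ 0 ⊎ (t ≡ 1 × c ≡ 1)

-- If all three colors were joined by a transition edge, each would have a single neighbour, and the
-- degree would be 3 instead of `4 + k`.
sum≤2 : ∀ {k} (t c : Fin 3 → ℕ) → (∀ i → Single (t i) (c i)) →
        sumᶠ c ≡ 4 + k → sumᶠ t ≤ 2
sum≤2 t c single eq
  with t zero | t (suc zero) | t (suc (suc zero)) | c zero | c (suc zero) | c (suc (suc zero))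
     | single zero | single (suc zero) | single (suc (suc zero))
... | _ | _ | _ | _ | _ | _ | inj₁ refl | inj₁ refl | inj₁ refl = z≤n
... | _ | _ | _ | _ | _ | _ | inj₁ refl | inj₁ refl | inj₂ (refl , _) = s≤s z≤n
... | _ | _ | _ | _ | _ | _ | inj₁ refl | inj₂ (refl , _) | inj₁ refl = s≤s z≤n
... | _ | _ | _ | _ | _ | _ | inj₁ refl | inj₂ (refl , _) | inj₂ (refl , _) = ≤-refl
... | _ | _ | _ | _ | _ | _ | inj₂ (refl , _) | inj₁ refl | inj₁ refl = s≤s z≤n
... | _ | _ | _ | _ | _ | _ | inj₂ (refl , _) | inj₁ refl | inj₂ (refl , _) = ≤-refl
... | _ | _ | _ | _ | _ | _ | inj₂ (refl , _) | inj₂ (refl , _) | inj₁ refl = ≤-refl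
... | _ | _ | _ | _ | _ | _ | inj₂ (refl , refl) | inj₂ (refl , refl) | inj₂ (refl , refl) =
  contradiction eq λ ()

-- A color with a transition edge gives `suc k * 1 + 1`. A color without one leaves both transition
-- edges to the other two colors, which then use one neighbour each, so `2 + k` of the `4 + k`
-- neighbours remain.
weight≡2+k : ∀ {k} (t c : Fin 3 → ℕ) → (∀ i → Single (t i) (c i)) →
             sumᶠ t ≡ 2 → sumᶠ c ≡ 4 + k → ∀ i → suc k * t i + c i ≡ 2 + k
weight≡2+k {k} t c single Σt Σc i =
  go (single i) (single (punchIn i zero)) (single (punchIn i (suc zero)))
     (trans (sym (sum-remove {i = i} t)) Σt) (trans (sym (sum-remove {i = i} c)) Σc)
  where
  go : ∀ {t₀ t₁ t₂ c₀ c₁ c₂} → Single t₀ c₀ → Single t₁ c₁ → Single t₂ c₂ →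
       t₀ + (t₁ + (t₂ + 0)) ≡ 2 → c₀ + (c₁ + (c₂ + 0)) ≡ 4 + k → suc k * t₀ + c₀ ≡ 2 + k
  go (inj₂ (refl , refl)) _ _ _ _ =
    trans (+-comm (suc k * 1) 1) (cong suc (*-identityʳ (suc k)))
  go {c₀ = c₀} (inj₁ refl) (inj₂ (refl , refl)) (inj₂ (refl , refl)) _ Σc =
    trans (cong (_+ c₀) (*-zeroʳ (suc k)))
          (suc-injective (suc-injective (trans (+-comm 2 c₀) Σc)))
  go (inj₁ refl) (inj₁ refl)       (inj₁ refl)       ()
  go (inj₁ refl) (inj₁ refl)       (inj₂ (refl , _)) ()
  go (inj₁ refl) (inj₂ (refl , _)) (inj₁ refl)       ()

sumᶠ-⟦≟⟧ : ∀ (c : Fin 4) v → sumᶠ (λ a → ⟦ c Fin.≟ a ⟧ * v) ≡ v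
sumᶠ-⟦≟⟧ zero                   v = trans (+-identityʳ _) (+-identityʳ v)
sumᶠ-⟦≟⟧ (suc zero)             v = trans (+-identityʳ _) (+-identityʳ v)
sumᶠ-⟦≟⟧ (suc (suc zero))       v = trans (+-identityʳ _) (+-identityʳ v)
sumᶠ-⟦≟⟧ (suc (suc (suc zero))) v = trans (+-identityʳ _) (+-identityʳ v)

-- Counting transition edges in a regular graph

module Regular (G : FiniteSimpleGraph) where
  open FiniteSimpleGraph G
  open Transitions G

  degree : Vertex → ℕ
  degree x = ∑ vertices (λ y → ⟦ Adj? x y ⟧)

  ∑-degrees : ∑ vertices degree ≡ 2 * ∣E∣
  ∑-degrees = trans (∑-unorderedPairs Adj? Adj-sym Adj-irrefl vertices)
                    (cong (2 *_) (sym (length-filter-∑ _ (unorderedPairs vertices))))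

  module _ (k : ℕ) (regular : ∀ x → degree x ≡ 4 + k) (K : Coloring 4) (proper : Proper K) where

    neighbours transitions : Vertex → Fin 4 → ℕ
    neighbours  x a = ∑ vertices (λ y → ⟦ K y Fin.≟ a ⟧ * ⟦ Adj? x y ⟧)
    transitions x a = ∑ vertices (λ y → ⟦ K y Fin.≟ a ⟧ * ⟦ Transition? K x y ⟧)

    degree-by-color : (g : Vertex → ℕ) →
      sumᶠ (λ a → ∑ vertices (λ y → ⟦ K y Fin.≟ a ⟧ * g y)) ≡ ∑ vertices g
    degree-by-color g = trans (sumᶠ-∑-comm (λ a y → ⟦ K y Fin.≟ a ⟧ * g y) vertices)
                              (∑-cong vertices λ y → sumᶠ-⟦≟⟧ (K y) (g y))

    neighbour? : ∀ x a y → Dec (K y ≡ a × Adj x y)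
    neighbour? x a y = (K y Fin.≟ a) ×-dec Adj? x y

    transition? : ∀ x a y → Dec (K y ≡ a × Transition K x y)
    transition? x a y = (K y Fin.≟ a) ×-dec Transition? K x y

    neighbours≡∑ : ∀ x a → neighbours x a ≡ ∑ vertices (λ y → ⟦ neighbour? x a y ⟧)
    neighbours≡∑ x a = ∑-cong vertices λ y → sym (⟦⟧-×-dec (K y Fin.≟ a) (Adj? x y))

    transitions≡∑ : ∀ x a → transitions x a ≡ ∑ vertices (λ y → ⟦ transition? x a y ⟧)
    transitions≡∑ x a = ∑-cong vertices λ y → sym (⟦⟧-×-dec (K y Fin.≟ a) (Transition? K x y))

    neighbours-own : ∀ x → neighbours x (K x) ≡ 0
    neighbours-own x = trans (neighbours≡∑ x (K x)) (∑-⟦⟧-none (neighbour? x (K x)) vertices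
      (All.tabulate λ _ (Ky≡Kx , xy) → proper x _ xy (sym Ky≡Kx)))

    transitions-own : ∀ x → transitions x (K x) ≡ 0
    transitions-own x = trans (transitions≡∑ x (K x)) (∑-⟦⟧-none (transition? x (K x)) vertices
      (All.tabulate λ _ (Ky≡Kx , xy , _) → proper x _ xy (sym Ky≡Kx)))

    -- Once some transition neighbour `y` of color `a` exists, `Transition-unique` makes it the only
    -- neighbour of that color, so both counts are 1.
    single : ∀ x a → Single (transitions x a) (neighbours x a)
    single x a with any? (transition? x a) vertices
    ... | no none = inj₁ (trans (transitions≡∑ x a) (∑-⟦⟧-none (transition? x a) vertices (¬Any⇒All¬ vertices none)))
    ... | yes some with satisfied some
    ...   | y , Ky≡a , t = inj₂
      ( trans (transitions≡∑ x a) (∑-⟦⟧-unique (transition? x a) unique (complete y) (Ky≡a , t)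
          λ z (Kz≡a , xz , _) → Transition-unique K t xz (trans Kz≡a (sym Ky≡a)))
      , trans (neighbours≡∑ x a) (∑-⟦⟧-unique (neighbour? x a) unique (complete y) (Ky≡a , proj₁ t)
          λ z (Kz≡a , xz) → Transition-unique K t xz (trans Kz≡a (sym Ky≡a))) )

    transitionDegree : Vertex → ℕ
    transitionDegree x = ∑ vertices (λ y → ⟦ Transition? K x y ⟧)

    -- A vertex has no neighbour of its own color, so counts over four colors reduce to the three
    -- others, enumerated by `punchIn (K x)`.
    sum-others : (g : Fin 4 → ℕ) (x : Vertex) → g (K x) ≡ 0 →
                 sumᶠ (λ i → g (punchIn (K x) i)) ≡ sumᶠ g
    sum-others g x g≡0 = sym (trans (sum-remove {i = K x} g) (cong (_+ sumᶠ (λ i → g (punchIn (K x) i))) g≡0))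

    sum-neighbours : ∀ x → sumᶠ (λ i → neighbours x (punchIn (K x) i)) ≡ 4 + k
    sum-neighbours x = trans (sum-others (neighbours x) x (neighbours-own x))
                             (trans (degree-by-color _) (regular x))

    sum-transitions : ∀ x → sumᶠ (λ i → transitions x (punchIn (K x) i)) ≡ transitionDegree x
    sum-transitions x = trans (sum-others (transitions x) x (transitions-own x)) (degree-by-color _)

    transitionDegree≤2 : ∀ x → transitionDegree x ≤ 2
    transitionDegree≤2 x = subst (_≤ 2) (sum-transitions x)
      (sum≤2 _ (neighbours x ∘ punchIn (K x)) (λ i → single x _) (sum-neighbours x))

    ∑-transitionDegrees : ∑ vertices transitionDegree ≡ 2 * ∣T∣ K
    ∑-transitionDegrees = begin
      ∑ vertices transitionDegree
        ≡⟨ ∑-unorderedPairs (Transition? K) (Transition-sym K) (Transition-irrefl K) vertices ⟩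
      2 * ∑ (unorderedPairs vertices) (λ p → ⟦ uncurry (Transition? K) p ⟧)
        -- Transition pairs are adjacent, so restricting the sum to edges loses nothing.
        ≡⟨ cong (2 *_) (∑-filter (uncurry Adj?) _ (unorderedPairs vertices)
             (λ p ¬adj → ⟦⟧-false (uncurry (Transition? K) p) (¬adj ∘ proj₁))) ⟨
      2 * ∑ edges (λ p → ⟦ uncurry (Transition? K) p ⟧)
        ≡⟨ cong (2 *_) (length-filter-∑ (uncurry (Transition? K)) edges) ⟨
      2 * ∣T∣ K ∎
      where open ≡-Reasoning

    module _ (extremal : ∣T∣ K * (4 + k) ≡ 2 * ∣E∣) where

      -- The bounds `transitionDegree≤2`, scaled by `4 + k`, add up to an equality by `extremal` and
      -- two uses of the handshake lemma, so each of them is attained. Writing `2 * ∣E∣` as a sum of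
      -- degrees avoids any count of the vertices.
      transitionDegree≡2 : ∀ x → transitionDegree x ≡ 2
      transitionDegree≡2 x = *-cancelˡ-≡ _ _ (4 + k)
        (∑-≡⇒≗ vertices (λ y → *-monoʳ-≤ (4 + k) (transitionDegree≤2 y)) totals (complete x))
        where
        open ≡-Reasoning
        totals : ∑ vertices (λ x → (4 + k) * transitionDegree x) ≡ ∑ vertices (λ x → (4 + k) * 2)
        totals = begin
          ∑ vertices (λ x → (4 + k) * transitionDegree x) ≡⟨ *-distribˡ-∑ (4 + k) _ vertices ⟨
          (4 + k) * ∑ vertices transitionDegree           ≡⟨ cong ((4 + k) *_) ∑-transitionDegrees ⟩
          (4 + k) * (2 * ∣T∣ K)                           ≡⟨ solve 2 (λ a b → a :* (con 2 :* b) := con 2 :* (b :* a)) refl (4 + k) (∣T∣ K) ⟩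
          2 * (∣T∣ K * (4 + k))                           ≡⟨ cong (2 *_) extremal ⟩
          2 * (2 * ∣E∣)                                   ≡⟨ cong (2 *_) ∑-degrees ⟨
          2 * ∑ vertices degree ≡⟨ *-distribˡ-∑ 2 _ vertices ⟩
          ∑ vertices (λ x → 2 * degree x) ≡⟨ ∑-cong vertices (λ x → trans (cong (2 *_) (regular x)) (*-comm 2 (4 + k))) ⟩
          ∑ vertices (λ x → (4 + k) * 2) ∎
          where open +-*-Solver using (solve; _:=_; _:*_; con)

      -- A transition edge is also counted by the second summand, so its weight is `suc k + 1`, that
      -- is `2 + k`.
      weight : Vertex → Vertex → ℕ
      weight x y = suc k * ⟦ Transition? K x y ⟧ + ⟦ Adj? x y ⟧

      weight-sym : ∀ x y → weight x y ≡ weight y x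
      weight-sym x y = cong₂ (λ t c → suc k * t + c)
        (⟦⟧-⇔ (Transition? K x y) (Transition? K y x) (mk⇔ (Transition-sym K) (Transition-sym K)))
        (⟦⟧-⇔ (Adj? x y) (Adj? y x) (mk⇔ Adj-sym Adj-sym))

      -- A vertex has either a single neighbour of color a, joined by a transition
      -- edge, or 2 + k of them, joined by other edges.
      ∑-weight : ∀ x {a} → K x ≢ a → ∑ vertices (λ y → ⟦ K y Fin.≟ a ⟧ * weight x y) ≡ 2 + k
      ∑-weight x {a} Kx≢a = begin
        ∑ vertices (λ y → ⟦ K y Fin.≟ a ⟧ * weight x y)
          ≡⟨ ∑-cong vertices (λ y → solve 4 (λ s p t c → p :* (s :* t :+ c) := s :* (p :* t) :+ p :* c) refl
               (suc k) ⟦ K y Fin.≟ a ⟧ ⟦ Transition? K x y ⟧ ⟦ Adj? x y ⟧) ⟩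
        ∑ vertices (λ y → suc k * (⟦ K y Fin.≟ a ⟧ * ⟦ Transition? K x y ⟧) + ⟦ K y Fin.≟ a ⟧ * ⟦ Adj? x y ⟧)
          ≡⟨ ∑-distrib-+ _ _ vertices ⟩
        ∑ vertices (λ y → suc k * (⟦ K y Fin.≟ a ⟧ * ⟦ Transition? K x y ⟧)) + neighbours x a
          ≡⟨ cong (_+ neighbours x a) (*-distribˡ-∑ (suc k) _ vertices) ⟨
        suc k * transitions x a + neighbours x a
          -- Since `a` differs from `K x`, it is one of the three colors over which `weight≡2+k` is
          -- indexed.
          ≡⟨ cong (λ b → suc k * transitions x b + neighbours x b) (Fin.punchIn-punchOut Kx≢a) ⟨
        suc k * transitions x (punchIn (K x) (punchOut Kx≢a)) + neighbours x (punchIn (K x) (punchOut Kx≢a))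
          ≡⟨ weight≡2+k (transitions x ∘ punchIn (K x)) (neighbours x ∘ punchIn (K x)) (λ i → single x _)
               (trans (sum-transitions x) (transitionDegree≡2 x)) (sum-neighbours x) (punchOut Kx≢a) ⟩
        2 + k ∎
        where
        open ≡-Reasoning
        open +-*-Solver using (solve; _:=_; _:+_; _:*_)

      ∑-weight-class : ∀ {c d} → c ≢ d →
        ∑ vertices (λ x → ⟦ K x Fin.≟ c ⟧ * ∑ vertices (λ y → ⟦ K y Fin.≟ d ⟧ * weight x y)) ≡
        (2 + k) * classSize K c
      ∑-weight-class {c} {d} c≢d = begin
        ∑ vertices (λ x → ⟦ K x Fin.≟ c ⟧ * ∑ vertices (λ y → ⟦ K y Fin.≟ d ⟧ * weight x y))
          ≡⟨ ∑-cong vertices pointwise ⟩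
        ∑ vertices (λ x → (2 + k) * ⟦ K x Fin.≟ c ⟧)
          ≡⟨ *-distribˡ-∑ (2 + k) _ vertices ⟨
        (2 + k) * ∑ vertices (λ x → ⟦ K x Fin.≟ c ⟧)
          ≡⟨ cong ((2 + k) *_) (length-filter-∑ _ vertices) ⟨
        (2 + k) * classSize K c ∎
        where
        open ≡-Reasoning
        pointwise : ∀ x → ⟦ K x Fin.≟ c ⟧ * ∑ vertices (λ y → ⟦ K y Fin.≟ d ⟧ * weight x y) ≡
                          (2 + k) * ⟦ K x Fin.≟ c ⟧
        pointwise x with K x Fin.≟ c
        ... | yes refl = trans (+-identityʳ _) (trans (∑-weight x c≢d) (sym (*-identityʳ (2 + k))))
        ... | no _     = sym (*-zeroʳ (2 + k))

      even : Even K
      even c d with c Fin.≟ d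
      ... | yes refl = refl
      ... | no  c≢d  = *-cancelˡ-≡ _ _ (2 + k) (begin
        (2 + k) * classSize K c
          ≡⟨ ∑-weight-class c≢d ⟨
        ∑ vertices (λ x → ⟦ K x Fin.≟ c ⟧ * ∑ vertices (λ y → ⟦ K y Fin.≟ d ⟧ * weight x y))
          ≡⟨ ∑-*-symmetric (λ x → ⟦ K x Fin.≟ c ⟧) (λ x → ⟦ K x Fin.≟ d ⟧) weight weight-sym vertices ⟩
        ∑ vertices (λ x → ⟦ K x Fin.≟ d ⟧ * ∑ vertices (λ y → ⟦ K y Fin.≟ c ⟧ * weight x y))
          ≡⟨ ∑-weight-class (c≢d ∘ sym) ⟩
        (2 + k) * classSize K d ∎)
        where open ≡-Reasoning

-- The group ℤ₂^ n

module _ {n : ℕ} where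

  𝟘 : ℤ₂^ n
  𝟘 = replicate n 0ℙ

  ⊕-assoc : (x y z : ℤ₂^ n) → (x ⊕ y) ⊕ z ≡ x ⊕ (y ⊕ z)
  ⊕-assoc = zipWith-assoc ℙ.+-assoc

  ⊕-comm : (x y : ℤ₂^ n) → x ⊕ y ≡ y ⊕ x
  ⊕-comm = zipWith-comm ℙ.+-comm

  ⊕-identityˡ : (x : ℤ₂^ n) → 𝟘 ⊕ x ≡ x
  ⊕-identityˡ = zipWith-identityˡ ℙ.+-identityˡ

  ⊕-identityʳ : (x : ℤ₂^ n) → x ⊕ 𝟘 ≡ x
  ⊕-identityʳ = zipWith-identityʳ ℙ.+-identityʳ

⊕-self : ∀ {n} (x : ℤ₂^ n) → x ⊕ x ≡ 𝟘
⊕-self []      = refl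
⊕-self (a ∷ x) = cong₂ _∷_ (ℙ.p+p≡0ℙ a) (⊕-self x)

module _ {n : ℕ} (x : ℤ₂^ n) where

  ⊕-cancel : ∀ y → x ⊕ (x ⊕ y) ≡ y
  ⊕-cancel y = trans (sym (⊕-assoc x x y)) (trans (cong (_⊕ y) (⊕-self x)) (⊕-identityˡ y))

  ⊕-injective : ∀ {y z} → x ⊕ y ≡ x ⊕ z → y ≡ z
  ⊕-injective {y} {z} eq = trans (sym (⊕-cancel y)) (trans (cong (x ⊕_) eq) (⊕-cancel z))

lookup-⊕ : ∀ {n} k (x y : ℤ₂^ n) → lookup (x ⊕ y) k ≡ lookup x k +₂ lookup y k
lookup-⊕ = lookup-zipWith _+₂_

lookup-f-≡ : ∀ {n} (k : Fin n) → lookup (f k) k ≡ 0ℙ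
lookup-f-≡ k = trans (lookup-⊕ k (e k) 𝟙)
  (cong₂ _+₂_ (lookup∘update k 𝟘 1ℙ) (lookup-replicate k 1ℙ))

lookup-f-≢ : ∀ {n} {k l : Fin n} → l ≢ k → lookup (f k) l ≡ 1ℙ
lookup-f-≢ {k = k} {l} l≢k = trans (lookup-⊕ l (e k) 𝟙)
  (cong₂ _+₂_ (trans (lookup∘update′ l≢k 𝟘 1ℙ) (lookup-replicate l 0ℙ)) (lookup-replicate l 1ℙ))

f-≢ : ∀ {n} {k l : Fin n} → k ≢ l → f k ≢ f l
f-≢ {k = k} k≢l eq
  with () ← trans (sym (lookup-f-≡ k)) (trans (cong (λ v → lookup v k) eq) (lookup-f-≢ k≢l))

𝟙≢f : ∀ {n} (k : Fin n) → 𝟙 ≢ f k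
𝟙≢f k eq
  with () ← trans (sym (lookup-replicate k 1ℙ)) (trans (cong (λ v → lookup v k) eq) (lookup-f-≡ k))

𝟙⊕f : ∀ {n} (k : Fin n) → 𝟙 ⊕ f k ≡ e k
𝟙⊕f k = trans (cong (𝟙 ⊕_) (⊕-comm (e k) 𝟙)) (⊕-cancel 𝟙 (e k))

f⊕f : ∀ {n} (k l : Fin n) → f k ⊕ f l ≡ e k ⊕ e l
f⊕f k l = trans (⊕-assoc (e k) 𝟙 (f l)) (cong (e k ⊕_) (𝟙⊕f l))

-- Hamming distance, weight and parity

hammingDistance-self : ∀ {n} (x : ℤ₂^ n) → hammingDistance x x ≡ 0
hammingDistance-self []       = refl
hammingDistance-self (0ℙ ∷ x) = hammingDistance-self x
hammingDistance-self (1ℙ ∷ x) = hammingDistance-self x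

hammingDistance-⊕ : ∀ {n} (x v : ℤ₂^ n) → hammingDistance x (x ⊕ v) ≡ wt v
hammingDistance-⊕ []       []       = refl
hammingDistance-⊕ (0ℙ ∷ x) (0ℙ ∷ v) = hammingDistance-⊕ x v
hammingDistance-⊕ (0ℙ ∷ x) (1ℙ ∷ v) = cong suc (hammingDistance-⊕ x v)
hammingDistance-⊕ (1ℙ ∷ x) (0ℙ ∷ v) = hammingDistance-⊕ x v
hammingDistance-⊕ (1ℙ ∷ x) (1ℙ ∷ v) = cong suc (hammingDistance-⊕ x v)

wt-𝟘 : ∀ n → wt (𝟘 {n}) ≡ 0
wt-𝟘 zero    = refl
wt-𝟘 (suc n) = wt-𝟘 n

wt-𝟙 : ∀ n → wt (𝟙 {n}) ≡ n
wt-𝟙 zero    = refl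
wt-𝟙 (suc n) = cong suc (wt-𝟙 n)

wt-e : ∀ {n} (k : Fin n) → wt (e k) ≡ 1
wt-e {suc n} zero    = cong suc (wt-𝟘 n)
wt-e         (suc k) = wt-e k

wt-f : ∀ {n} (k : Fin (suc n)) → wt (f k) ≡ n
wt-f {n}     zero    = trans (cong wt (⊕-identityˡ (𝟙 {n}))) (wt-𝟙 n)
wt-f {suc n} (suc k) = cong suc (wt-f k)

parity-suc : ∀ n → parity (suc n) ≡ parity n ⁻¹
parity-suc = ℙ.+-homo-+ 1

parity-wt-⊕ : ∀ {n} (x y : ℤ₂^ n) → parity (wt (x ⊕ y)) ≡ parity (wt x) +₂ parity (wt y)
parity-wt-⊕ []       []       = refl
parity-wt-⊕ (0ℙ ∷ x) (0ℙ ∷ y) = parity-wt-⊕ x y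
parity-wt-⊕ (0ℙ ∷ x) (1ℙ ∷ y) =
  trans (parity-suc (wt (x ⊕ y))) (trans (cong _⁻¹ (parity-wt-⊕ x y))
    (trans (sym (+-⁻¹ʳ (parity (wt x)) (parity (wt y))))
           (cong (parity (wt x) +₂_) (sym (parity-suc (wt y))))))
  where
  +-⁻¹ʳ : ∀ p q → p +₂ q ⁻¹ ≡ (p +₂ q) ⁻¹
  +-⁻¹ʳ 0ℙ q = refl
  +-⁻¹ʳ 1ℙ q = refl
parity-wt-⊕ (1ℙ ∷ x) (0ℙ ∷ y) =
  trans (parity-suc (wt (x ⊕ y))) (trans (cong _⁻¹ (parity-wt-⊕ x y))
    (trans (+-⁻¹ˡ (parity (wt x)) (parity (wt y)))
           (cong (_+₂ parity (wt y)) (sym (parity-suc (wt x))))))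
  where
  +-⁻¹ˡ : ∀ p q → (p +₂ q) ⁻¹ ≡ p ⁻¹ +₂ q
  +-⁻¹ˡ 0ℙ q = refl
  +-⁻¹ˡ 1ℙ q = ℙ.⁻¹-involutive q
parity-wt-⊕ (1ℙ ∷ x) (1ℙ ∷ y) =
  trans (parity-wt-⊕ x y) (trans (⁻¹+⁻¹ (parity (wt x)) (parity (wt y)))
    (sym (cong₂ _+₂_ (parity-suc (wt x)) (parity-suc (wt y)))))
  where
  ⁻¹+⁻¹ : ∀ p q → p +₂ q ≡ p ⁻¹ +₂ q ⁻¹
  ⁻¹+⁻¹ 0ℙ q = sym (ℙ.⁻¹-involutive q)
  ⁻¹+⁻¹ 1ℙ q = refl

parity≡0⇒2∣ : ∀ n → parity n ≡ 0ℙ → 2 ∣ n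
parity≡0⇒2∣ zero          _  = 2 ∣0
parity≡0⇒2∣ (suc (suc n)) eq = ∣m∣n⇒∣m+n ∣-refl (parity≡0⇒2∣ n eq)

-- The vector `x` is changed into `y` one coordinate at a time, the tail first with head `a` fixed,
-- then the head. Each actual change is a translation by some `e k` under which `F` is invariant.
invariant⇒≡ : {A : Set} {n : ℕ} (F : ℤ₂^ n → A) (x y : ℤ₂^ n) →
              (∀ k → lookup x k ≡ lookup y k ⊎ (∀ z → F (z ⊕ e k) ≡ F z)) → F x ≡ F y
invariant⇒≡ F []      []      inv = refl
invariant⇒≡ F (a ∷ x) (b ∷ y) inv =
  trans (invariant⇒≡ (F ∘ (a ∷_)) x y inv-tail) (head a b (inv zero))
  where
  inv-tail : ∀ k → lookup x k ≡ lookup y k ⊎ (∀ z → F (a ∷ z ⊕ e k) ≡ F (a ∷ z))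
  inv-tail k with inv (suc k)
  ... | inj₁ eq    = inj₁ eq
  ... | inj₂ shift = inj₂ λ z →
    -- The vector `e (suc k)` has head `0ℙ`, so the translation turns the head into `a +₂ 0ℙ`.
    trans (cong (λ c → F (c ∷ z ⊕ e k)) (sym (ℙ.+-identityʳ a))) (shift (a ∷ z))

  flip : (∀ z → F (z ⊕ e zero) ≡ F z) → ∀ a → F (a ∷ y) ≡ F (a +₂ 1ℙ ∷ y)
  flip shift a = trans (sym (shift (a ∷ y))) (cong (λ v → F (a +₂ 1ℙ ∷ v)) (⊕-identityʳ y))

  head : ∀ a b → a ≡ b ⊎ (∀ z → F (z ⊕ e zero) ≡ F z) → F (a ∷ y) ≡ F (b ∷ y)
  head a  b  (inj₁ refl)  = refl
  head 0ℙ 0ℙ (inj₂ shift) = refl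
  head 0ℙ 1ℙ (inj₂ shift) = flip shift 0ℙ
  head 1ℙ 0ℙ (inj₂ shift) = flip shift 1ℙ
  head 1ℙ 1ℙ (inj₂ shift) = refl

-- Regularity of H₂ n (n ∸ 1)

∑-allVectors : ∀ n (g : ℤ₂^ suc n → ℕ) →
               ∑ (allVectors (suc n)) g ≡
               ∑ (allVectors n) (g ∘ (0ℙ ∷_)) + ∑ (allVectors n) (g ∘ (1ℙ ∷_))
∑-allVectors n g = begin
  sum (map g (map (0ℙ ∷_) vs ++ (map (1ℙ ∷_) vs ++ [])))
    ≡⟨ cong sum (map-++ g (map (0ℙ ∷_) vs) _) ⟩
  sum (map g (map (0ℙ ∷_) vs) ++ map g (map (1ℙ ∷_) vs ++ []))
    ≡⟨ sum-++ (map g (map (0ℙ ∷_) vs)) _ ⟩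
  sum (map g (map (0ℙ ∷_) vs)) + sum (map g (map (1ℙ ∷_) vs ++ []))
    ≡⟨ cong₂ _+_ (cong sum (sym (map-∘ vs)))
         (trans (cong (∑′ g) (++-identityʳ (map (1ℙ ∷_) vs))) (cong sum (sym (map-∘ vs)))) ⟩
  ∑ vs (g ∘ (0ℙ ∷_)) + ∑ vs (g ∘ (1ℙ ∷_)) ∎
  where
  open ≡-Reasoning
  vs = allVectors n
  ∑′ : (ℤ₂^ suc n → ℕ) → List (ℤ₂^ suc n) → ℕ
  ∑′ g xs = ∑ xs g

far : ∀ d {n} → ℤ₂^ n → ℕ
far d {n} x = ∑ (allVectors n) (λ y → ⟦ d ≤? hammingDistance x y ⟧)

-- The vectors `y` split by their first entry: if it differs from `a`, the tail needs only distance
-- `d`; if it agrees, the tail needs all of `suc d`.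
far-∷ : ∀ d {n} a (x : ℤ₂^ n) → far (suc d) (a ∷ x) ≡ far d x + far (suc d) x
far-∷ d {n} a x = trans (∑-allVectors n _) (split a)
  where
  differ : ∑ (allVectors n) (λ y → ⟦ suc d ≤? suc (hammingDistance x y) ⟧) ≡ far d x
  differ = ∑-cong (allVectors n) λ y →
    ⟦⟧-⇔ (suc d ≤? suc (hammingDistance x y)) (d ≤? hammingDistance x y) (mk⇔ s≤s⁻¹ s≤s)

  split : ∀ a → ∑ (allVectors n) (λ y → ⟦ suc d ≤? hammingDistance (a ∷ x) (0ℙ ∷ y) ⟧) +
                ∑ (allVectors n) (λ y → ⟦ suc d ≤? hammingDistance (a ∷ x) (1ℙ ∷ y) ⟧) ≡
                far d x + far (suc d) x
  split 0ℙ = trans (cong (far (suc d) x +_) differ) (+-comm (far (suc d) x) (far d x))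
  split 1ℙ = cong (_+ far (suc d) x) differ

far-1+n : ∀ {n} (x : ℤ₂^ n) → far (suc n) x ≡ 0
far-1+n {n} x = ∑-⟦⟧-none (λ y → suc n ≤? hammingDistance x y) (allVectors n)
  (All.tabulate λ {y} _ n< → 1+n≰n (≤-trans n< (count≤n _ (zip x y))))

far-n : ∀ {n} (x : ℤ₂^ n) → far n x ≡ 1
far-n []              = refl
far-n {suc n} (a ∷ x) = trans (far-∷ n a x) (cong₂ _+_ (far-n x) (far-1+n x))

far-n-1 : ∀ {n} (x : ℤ₂^ suc n) → far n x ≡ 2 + n
far-n-1 {zero}  x       = refl
far-n-1 {suc n} (a ∷ x) = trans (far-∷ n a x)
  (trans (cong₂ _+_ (far-n-1 x) (far-n x)) (+-comm (2 + n) 1))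

-- Four distinct colors exhaust the palette

injective⇒surjective : ∀ {n} (g : Fin n → Fin n) → (∀ i j → g i ≡ g j → i ≡ j) →
                       ∀ x → ∃ λ i → g i ≡ x
injective⇒surjective {suc n} g g-injective x with Fin.any? (λ i → g i Fin.≟ x)
... | yes hit  = hit
-- Deleting a missed value `x` from the codomain would give an injection into a smaller finite set.
... | no  miss = contradiction (Fin.injective⇒≤ avoid-injective) 1+n≰n
  where
  x≢g : ∀ i → x ≢ g i
  x≢g i eq = miss (i , sym eq)

  avoid : Fin (suc n) → Fin n
  avoid i = punchOut (x≢g i)

  avoid-injective : ∀ {i j} → avoid i ≡ avoid j → i ≡ j
  avoid-injective {i} {j} eq = g-injective i j (Fin.punchOut-injective (x≢g i) (x≢g j) eq)

distinct-colors-exhaust : {a b c d : Fin 4} →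
  a ≢ b → a ≢ c → a ≢ d → b ≢ c → b ≢ d → c ≢ d → ∀ x → x ≡ a ⊎ x ≡ b ⊎ x ≡ c ⊎ x ≡ d
distinct-colors-exhaust {a} {b} {c} {d} ab ac ad bc bd cd x
  with injective⇒surjective (lookup (a ∷ b ∷ c ∷ d ∷ [])) (lookup-injective distinct) x
  where
  distinct : Uniqueᵛ (a ∷ b ∷ c ∷ d ∷ [])
  distinct = (ab ∷ ac ∷ ad ∷ []) ∷ (bc ∷ bd ∷ []) ∷ (cd ∷ []) ∷ [] ∷ []
... | zero                   , eq = inj₁ (sym eq)
... | suc zero               , eq = inj₂ (inj₁ (sym eq))
... | suc (suc zero)         , eq = inj₂ (inj₂ (inj₁ (sym eq)))
... | suc (suc (suc zero))   , eq = inj₂ (inj₂ (inj₂ (sym eq)))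

-- Colorings whose transition edges have two directions

module Hamming (k : ℕ) where

  n : ℕ
  n = 3 + k

  open FiniteSimpleGraph (H₂ n (n ∸ 1))
  open Transitions (H₂ n (n ∸ 1))

  H₂-regular : ∀ x → Regular.degree (H₂ n (n ∸ 1)) x ≡ 4 + k
  H₂-regular x = trans
    (∑-cong (allVectors n) λ y → ⟦⟧-⇔ (Adj? x y) (2 + k ≤? hammingDistance x y)
      (mk⇔ proj₂ λ far → (λ { refl → 0≱ far }) , far))
    (far-n-1 x)
    where
    0≱ : ¬ 2 + k ≤ hammingDistance x x
    0≱ far with () ← subst (2 + k ≤_) (hammingDistance-self x) far

  -- The graph is the Cayley graph of `ℤ₂^ n` on these vectors, which are `𝟙` and all `f i`; the
  -- threshold `2 + k` is n - 1.
  Generator : ℤ₂^ n → Set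
  Generator v = 2 + k ≤ wt v

  𝟙-generator : Generator 𝟙
  𝟙-generator = ≤-trans (n≤1+n (2 + k)) (≤-reflexive (sym (wt-𝟙 n)))

  f-generator : ∀ i → Generator (f i)
  f-generator i = ≤-reflexive (sym (wt-f i))

  Adj-⊕ : ∀ {v} x → Generator v → Adj x (x ⊕ v)
  Adj-⊕ {v} x gen = x≢x⊕v , subst (2 + k ≤_) (sym (hammingDistance-⊕ x v)) gen
    where
    x≢x⊕v : x ≢ x ⊕ v
    x≢x⊕v eq with () ← subst (2 + k ≤_)
      (trans (sym (hammingDistance-⊕ x v))
             (trans (cong (hammingDistance x) (sym eq)) (hammingDistance-self x))) gen

  module TwoTransitions (K : Coloring 4) (proper : Proper K) (g h : ℤ₂^ n) (g≢h : g ≢ h)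
                        (transition : TransitionsAre K g h) where

    transition-g : ∀ x → Transition K x (x ⊕ g)
    transition-g x = Equivalence.from (transition x (x ⊕ g)) (inj₁ (⊕-cancel x g))

    transition-h : ∀ x → Transition K x (x ⊕ h)
    transition-h x = Equivalence.from (transition x (x ⊕ h)) (inj₂ (⊕-cancel x h))

    Other : ℤ₂^ n → Set
    Other v = Generator v × v ≢ g × v ≢ h

    K-≢ : ∀ {v} x → Generator v → K x ≢ K (x ⊕ v)
    K-≢ x gen = proper x _ (Adj-⊕ x gen)

    -- By `Transition-unique`, `x ⊕ g` is the only neighbour of `x` with its color.
    g≢ : ∀ {v} x → Generator v → v ≢ g → K (x ⊕ g) ≢ K (x ⊕ v)
    g≢ x gen v≢g eq =
      v≢g (⊕-injective x (Transition-unique K (transition-g x) (Adj-⊕ x gen) (sym eq)))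

    h≢ : ∀ {v} x → Generator v → v ≢ h → K (x ⊕ h) ≢ K (x ⊕ v)
    h≢ x gen v≢h eq =
      v≢h (⊕-injective x (Transition-unique K (transition-h x) (Adj-⊕ x gen) (sym eq)))

    K≢g : ∀ x → K x ≢ K (x ⊕ g)
    K≢g x = proper x _ (proj₁ (transition-g x))

    K≢h : ∀ x → K x ≢ K (x ⊕ h)
    K≢h x = proper x _ (proj₁ (transition-h x))

    Kg≢Kh : ∀ x → K (x ⊕ g) ≢ K (x ⊕ h)
    Kg≢Kh x eq = g≢h (⊕-injective x (Transition-unique K (transition-h x) (proj₁ (transition-g x)) eq))

    -- The vertex `x` and its neighbours along `g`, `h` and `u` have pairwise distinct colors, so
    -- all four colors occur among them.
    covered : ∀ {u} → Other u → ∀ x c →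
              c ≡ K x ⊎ c ≡ K (x ⊕ g) ⊎ c ≡ K (x ⊕ h) ⊎ c ≡ K (x ⊕ u)
    covered (gen , u≢g , u≢h) x = distinct-colors-exhaust
      (K≢g x) (K≢h x) (K-≢ x gen) (Kg≢Kh x) (g≢ x gen u≢g) (h≢ x gen u≢h)

    -- The color of `x ⊕ v` is none of those of `x`, `x ⊕ g` and `x ⊕ h`, so by `covered` only that
    -- of `x ⊕ u` remains.
    others-agree : ∀ {u v} → Other u → Other v → ∀ x → K (x ⊕ u) ≡ K (x ⊕ v)
    others-agree {v = v} u-other (gen , v≢g , v≢h) x with covered u-other x (K (x ⊕ v))
    ... | inj₁ eq                 = contradiction (sym eq) (K-≢ x gen)
    ... | inj₂ (inj₁ eq)          = contradiction (sym eq) (g≢ x gen v≢g)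
    ... | inj₂ (inj₂ (inj₁ eq))   = contradiction (sym eq) (h≢ x gen v≢h)
    ... | inj₂ (inj₂ (inj₂ eq))   = sym eq

    K-shift : ∀ {u v} → Other u → Other v → ∀ x → K (x ⊕ (u ⊕ v)) ≡ K x
    K-shift {u} {v} u-other v-other x = begin
      K (x ⊕ (u ⊕ v)) ≡⟨ cong K (⊕-assoc x u v) ⟨
      -- Seen from `x ⊕ u`, the step along `v` has the same color as the step along `u`, which leads
      -- back to `x`.
      K ((x ⊕ u) ⊕ v) ≡⟨ others-agree v-other u-other (x ⊕ u) ⟩
      K ((x ⊕ u) ⊕ u) ≡⟨ cong K (⊕-assoc x u u) ⟩
      K (x ⊕ (u ⊕ u)) ≡⟨ cong (λ w → K (x ⊕ w)) (⊕-self u) ⟩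
      K (x ⊕ 𝟘)       ≡⟨ cong K (⊕-identityʳ x) ⟩
      K x ∎
      where open ≡-Reasoning

    module _ (q : ℤ₂^ n → Parity × Parity) (q-fibres : ∀ x y → q x ≡ q y → K x ≡ K y)
             {u : ℤ₂^ n} (u-other : Other u) (q-𝟘 : q 𝟘 ≡ (0ℙ , 0ℙ)) (q-g : q g ≡ (0ℙ , 1ℙ))
             (q-h : q h ≡ (1ℙ , 0ℙ)) (q-u : q u ≡ (1ℙ , 1ℙ)) where

      -- The color of each fibre of `q` is read off at a representative: `𝟘` or its neighbour along
      -- `g`, `h` or `u`. The form `𝟘 ⊕ v` matches the facts about the neighbours of a vertex.
      color : Parity × Parity → Fin 4
      color (0ℙ , 0ℙ) = K 𝟘
      color (0ℙ , 1ℙ) = K (𝟘 ⊕ g)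
      color (1ℙ , 0ℙ) = K (𝟘 ⊕ h)
      color (1ℙ , 1ℙ) = K (𝟘 ⊕ u)

      q-⊕ : ∀ {v p} → q v ≡ p → q (𝟘 ⊕ v) ≡ p
      q-⊕ {v} eq = trans (cong q (⊕-identityˡ v)) eq

      color-q : ∀ x p → q x ≡ p → K x ≡ color p
      color-q x (0ℙ , 0ℙ) eq = q-fibres _ _ (trans eq (sym q-𝟘))
      color-q x (0ℙ , 1ℙ) eq = q-fibres _ _ (trans eq (sym (q-⊕ q-g)))
      color-q x (1ℙ , 0ℙ) eq = q-fibres _ _ (trans eq (sym (q-⊕ q-h)))
      color-q x (1ℙ , 1ℙ) eq = q-fibres _ _ (trans eq (sym (q-⊕ q-u)))

      K≢u : K 𝟘 ≢ K (𝟘 ⊕ u)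
      K≢u = K-≢ 𝟘 (proj₁ u-other)

      Kg≢u : K (𝟘 ⊕ g) ≢ K (𝟘 ⊕ u)
      Kg≢u = g≢ 𝟘 (proj₁ u-other) (proj₁ (proj₂ u-other))

      Kh≢u : K (𝟘 ⊕ h) ≢ K (𝟘 ⊕ u)
      Kh≢u = h≢ 𝟘 (proj₁ u-other) (proj₂ (proj₂ u-other))

      color-injective : ∀ p p′ → color p ≡ color p′ → p ≡ p′
      color-injective (0ℙ , 0ℙ) (0ℙ , 0ℙ) eq = refl
      color-injective (0ℙ , 0ℙ) (0ℙ , 1ℙ) eq = contradiction eq (K≢g 𝟘)
      color-injective (0ℙ , 0ℙ) (1ℙ , 0ℙ) eq = contradiction eq (K≢h 𝟘)
      color-injective (0ℙ , 0ℙ) (1ℙ , 1ℙ) eq = contradiction eq K≢u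
      color-injective (0ℙ , 1ℙ) (0ℙ , 0ℙ) eq = contradiction (sym eq) (K≢g 𝟘)
      color-injective (0ℙ , 1ℙ) (0ℙ , 1ℙ) eq = refl
      color-injective (0ℙ , 1ℙ) (1ℙ , 0ℙ) eq = contradiction eq (Kg≢Kh 𝟘)
      color-injective (0ℙ , 1ℙ) (1ℙ , 1ℙ) eq = contradiction eq Kg≢u
      color-injective (1ℙ , 0ℙ) (0ℙ , 0ℙ) eq = contradiction (sym eq) (K≢h 𝟘)
      color-injective (1ℙ , 0ℙ) (0ℙ , 1ℙ) eq = contradiction (sym eq) (Kg≢Kh 𝟘)
      color-injective (1ℙ , 0ℙ) (1ℙ , 0ℙ) eq = refl
      color-injective (1ℙ , 0ℙ) (1ℙ , 1ℙ) eq = contradiction eq Kh≢u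
      color-injective (1ℙ , 1ℙ) (0ℙ , 0ℙ) eq = contradiction (sym eq) K≢u
      color-injective (1ℙ , 1ℙ) (0ℙ , 1ℙ) eq = contradiction (sym eq) Kg≢u
      color-injective (1ℙ , 1ℙ) (1ℙ , 0ℙ) eq = contradiction (sym eq) Kh≢u
      color-injective (1ℙ , 1ℙ) (1ℙ , 1ℙ) eq = refl

      color-surjective : ∀ c → ∃ λ p → color p ≡ c
      color-surjective c with covered u-other 𝟘 c
      ... | inj₁ eq               = (0ℙ , 0ℙ) , sym eq
      ... | inj₂ (inj₁ eq)        = (0ℙ , 1ℙ) , sym eq
      ... | inj₂ (inj₂ (inj₁ eq)) = (1ℙ , 0ℙ) , sym eq
      ... | inj₂ (inj₂ (inj₂ eq)) = (1ℙ , 1ℙ) , sym eq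

      color↔ : (Parity × Parity) ↔ Fin 4
      color↔ = mk↔ₛ′ color (proj₁ ∘ color-surjective) (proj₂ ∘ color-surjective)
        λ p → color-injective _ p (proj₂ (color-surjective (color p)))

      -- By `q-fibres` the coloring `K` factors through `q`, and the four representatives have
      -- different colors, so distinct fibres never share a color.
      classes-are-fibres :
        HasColorClasses K λ p x → proj₁ (q x) ≡ proj₁ p × proj₂ (q x) ≡ proj₂ p
      classes-are-fibres = color↔ , λ p x → mk⇔
        (λ eq → let q≡p = color-injective _ p (trans (sym (color-q x _ refl)) eq)
                in cong proj₁ q≡p , cong proj₂ q≡p)
        (λ (eq₁ , eq₂) → color-q x p (cong₂ _,_ eq₁ eq₂))

  -- For `l` other than `i` and `j`, both `𝟙` and `f l` are remaining generators with sum `e l`.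
  -- Hence `K` ignores coordinate `l` and depends only on coordinates `i` and `j`.
  coordinate-coloring : (K : Coloring 4) → Proper K → ∀ i j → i ≢ j →
    TransitionsAre K (f i) (f j) → HasColorClasses K (coordinateClass i j)
  coordinate-coloring K proper i j i≢j transition =
    classes-are-fibres q fibres 𝟙-other
      (cong₂ _,_ (lookup-replicate i 0ℙ) (lookup-replicate j 0ℙ))
      (cong₂ _,_ (lookup-f-≡ i) (lookup-f-≢ (i≢j ∘ sym)))
      (cong₂ _,_ (lookup-f-≢ i≢j) (lookup-f-≡ j))
      (cong₂ _,_ (lookup-replicate i 1ℙ) (lookup-replicate j 1ℙ))
    where
    open TwoTransitions K proper (f i) (f j) (f-≢ i≢j) transition

    q : ℤ₂^ n → Parity × Parity
    q x = lookup x i , lookup x j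

    𝟙-other : Other 𝟙
    𝟙-other = 𝟙-generator , 𝟙≢f i , 𝟙≢f j

    fibres : ∀ x y → q x ≡ q y → K x ≡ K y
    fibres x y eq = invariant⇒≡ K x y invariant
      where
      invariant : ∀ l → lookup x l ≡ lookup y l ⊎ (∀ z → K (z ⊕ e l) ≡ K z)
      invariant l with l Fin.≟ i | l Fin.≟ j
      ... | yes refl | _        = inj₁ (cong proj₁ eq)
      ... | no _     | yes refl = inj₁ (cong proj₂ eq)
      ... | no l≢i   | no l≢j   = inj₂ λ z →
        trans (cong (λ v → K (z ⊕ v)) (sym (𝟙⊕f l)))
              (K-shift 𝟙-other (f-generator l , f-≢ l≢i , f-≢ l≢j) z)

  -- Here the remaining generators are the `f i` with `i ≢ j`, whose pairwise sums are `e i ⊕ e l`.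
  -- Flipping two coordinates outside `j` preserves the parity of the weight and coordinate `j`, and
  -- these two values determine the color.
  parity-coloring : (K : Coloring 4) → Proper K → ∀ j →
    TransitionsAre K 𝟙 (f j) → 2 ∣ n × HasColorClasses K (𝒜 j)
  parity-coloring K proper j transition =
    parity≡0⇒2∣ n n-even ,
    classes-are-fibres q fibres (f-other l≢j) q-𝟘
      (cong₂ _,_ (trans (cong parity (wt-𝟙 n)) n-even) (lookup-replicate j 1ℙ))
      (cong₂ _,_ (parity-wt-f j) (lookup-f-≡ j))
      (cong₂ _,_ (parity-wt-f l) (lookup-f-≢ (l≢j ∘ sym)))
    where
    open TwoTransitions K proper 𝟙 (f j) (𝟙≢f j) transition

    q : ℤ₂^ n → Parity × Parity
    q x = parity (wt x) , lookup x j

    q-𝟘 : q 𝟘 ≡ (0ℙ , 0ℙ)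
    q-𝟘 = cong₂ _,_ (cong parity (wt-𝟘 n)) (lookup-replicate j 0ℙ)

    another : ∀ j → ∃ λ (l : Fin n) → l ≢ j
    another zero    = suc zero , λ ()
    another (suc _) = zero , λ ()

    l : Fin n
    l = proj₁ (another j)

    l≢j : l ≢ j
    l≢j = proj₂ (another j)

    f-other : ∀ {i} → i ≢ j → Other (f i)
    f-other {i} i≢j = f-generator i , (𝟙≢f i ∘ sym) , f-≢ i≢j

    -- Repairing the parity in coordinate l ≢ j turns K into a function that is
    -- invariant under each e i with i ≢ j separately.
    correct : Parity → ℤ₂^ n → ℤ₂^ n
    correct 0ℙ z = z
    correct 1ℙ z = z ⊕ e l

    -- Flipping coordinate `i` reverses the parity defect `s`, so the correction by `e l` is either
    -- introduced or dropped. In both cases the two arguments of `K` differ by `e i ⊕ e l`, which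
    -- `K-shift` absorbs.
    correct-invariant : ∀ {i} → i ≢ j → ∀ s z → K (correct (s ⁻¹) (z ⊕ e i)) ≡ K (correct s z)
    correct-invariant {i} i≢j 0ℙ z =
      trans (cong K (trans (⊕-assoc z (e i) (e l)) (cong (z ⊕_) (sym (f⊕f i l)))))
            (K-shift (f-other i≢j) (f-other l≢j) z)
    correct-invariant {i} i≢j 1ℙ z = begin
      K (z ⊕ e i)                     ≡⟨ cong (λ v → K (z ⊕ v)) (⊕-cancel (e l) (e i)) ⟨
      K (z ⊕ (e l ⊕ (e l ⊕ e i)))     ≡⟨ cong K (⊕-assoc z (e l) _) ⟨
      K ((z ⊕ e l) ⊕ (e l ⊕ e i))     ≡⟨ cong (λ v → K ((z ⊕ e l) ⊕ v)) (f⊕f l i) ⟨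
      K ((z ⊕ e l) ⊕ (f l ⊕ f i))     ≡⟨ K-shift (f-other l≢j) (f-other i≢j) (z ⊕ e l) ⟩
      K (z ⊕ e l) ∎
      where open ≡-Reasoning

    fibres : ∀ x y → q x ≡ q y → K x ≡ K y
    fibres x y eq = begin
      K x ≡⟨ F-own x refl ⟨
      F x ≡⟨ invariant⇒≡ F x y invariant ⟩
      F y ≡⟨ F-own y (cong proj₁ eq) ⟩
      K y ∎
      where
      open ≡-Reasoning
      ν : Parity
      ν = parity (wt x)

      -- With target parity `ν`, that of `x`, the correction is void on vectors of this parity.
      -- Hence `F` agrees with `K` at `x` and, by `eq`, at `y`.
      F : ℤ₂^ n → Fin 4
      F z = K (correct (ν +₂ parity (wt z)) z)

      F-own : ∀ z → ν ≡ parity (wt z) → F z ≡ K z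
      F-own z eq = cong (λ s → K (correct s z))
        (trans (cong (ν +₂_) (sym eq)) (ℙ.p+p≡0ℙ ν))

      flip-parity : ∀ i z → ν +₂ parity (wt (z ⊕ e i)) ≡ (ν +₂ parity (wt z)) ⁻¹
      flip-parity i z = begin
        ν +₂ parity (wt (z ⊕ e i))              ≡⟨ cong (ν +₂_) (parity-wt-⊕ z (e i)) ⟩
        ν +₂ (parity (wt z) +₂ parity (wt (e i))) ≡⟨ cong (λ m → ν +₂ (parity (wt z) +₂ parity m)) (wt-e i) ⟩
        ν +₂ (parity (wt z) +₂ 1ℙ)              ≡⟨ ℙ.+-assoc ν (parity (wt z)) 1ℙ ⟨
        (ν +₂ parity (wt z)) +₂ 1ℙ              ≡⟨ ℙ.+-comm _ 1ℙ ⟩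
        (ν +₂ parity (wt z)) ⁻¹ ∎

      invariant : ∀ i → lookup x i ≡ lookup y i ⊎ (∀ z → F (z ⊕ e i) ≡ F z)
      invariant i with i Fin.≟ j
      ... | yes refl = inj₁ (cong proj₂ eq)
      ... | no  i≢j  = inj₂ λ z →
        trans (cong (λ s → K (correct s (z ⊕ e i))) (flip-parity i z)) 
              (correct-invariant i≢j (ν +₂ parity (wt z)) z)

    n-even : parity n ≡ 0ℙ
    n-even with parity n in eq
    ... | 0ℙ = refl
    -- For odd n the vector `f j` has even weight n - 1 and entry 0 at `j`, so `q` takes the same
    -- value there as at `𝟘`. Then `fibres` would give two adjacent vertices the same color.
    ... | 1ℙ = contradiction
      (fibres 𝟘 (𝟘 ⊕ f j) (trans q-𝟘 (sym (trans (cong q (⊕-identityˡ (f j)))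
        (cong₂ _,_ (trans (cong parity (wt-f j)) (trans (sym (ℙ.suc-homo-⁻¹ (2 + k))) (cong _⁻¹ eq)))
                   (lookup-f-≡ j))))))
      (K≢h 𝟘)

    parity-wt-f : ∀ i → parity (wt (f i)) ≡ 1ℙ
    parity-wt-f i = trans (cong parity (wt-f i))
      (trans (sym (ℙ.suc-homo-⁻¹ (2 + k))) (cong _⁻¹ n-even))

open import Data.Integer using (+_)

theorem5p3 : ∀ n → (n≥3 : 3 ≤ n) →
    let open FiniteSimpleGraph (H₂ n (n ∸ 1)) in
    (K : Coloring 4) → Proper K →
    (∀ (i j : Fin n) → i <ᶠ j → TransitionsAre K (f i) (f j) → HasColorClasses K (coordinateClass i j))
    × (∀ (j : Fin n) → TransitionsAre K 𝟙 (f j) → 2 ∣ n × HasColorClasses K (𝒜 j))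
    × (rb {{H₂-nonZero n≥3}} K ≡ + 2 / suc n → Even K)
theorem5p3 (suc (suc (suc k))) n≥3@(s≤s (s≤s (s≤s z≤n))) K proper =
    (λ i j i<j → coordinate-coloring K proper i j (Fin.<⇒≢ i<j))
  , parity-coloring K proper
  , λ rb≡ → Regular.even (H₂ (3 + k) (2 + k)) k H₂-regular K proper
      -- Cross-multiplying the two fractions gives `extremal`; the denominator n + 1 is the degree
      -- `4 + k`.
      (normalize-injective-≃ (∣T∣ K) 2 ∣E∣ (4 + k) {{H₂-nonZero n≥3}} rb≡)
  where
  open FiniteSimpleGraph (H₂ (3 + k) (2 + k)) using (∣T∣; ∣E∣)
  open Hamming k
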